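{- Let $S\neq\mathbb{N}$ be a numerical semigroup with $c(S)\le 2m(S)$. Then $W(S)=0$ if and only if $S=T_{m,1}$ or $S=T_{m,2}$ for some integer $m\ge2$, or $S=\langle 3,4\rangle$.
   Context: $\mathbb{N}=\{0,1,2,\dots\}$. A numerical semigroup is a submonoid $S\subseteq\mathbb{N}$ (under addition) with finite complement. Let $S\ne\mathbb{N}$. The multiplicity $m(S)$ is the least positive element of $S$; $F$ is the largest element of $\mathbb{N}\setminus S$, $c(S)=F+1$ is the conductor, and $n(S)=|S\cap[0,c(S))|$. The embedding dimension $e(S)$ is the cardinality of the unique minimal system of generators of $S$. The Wilf number is $W(S)=e(S)n(S)-c(S)$. $\langle a_1,\dots,a_r\rangle$ denotes the submonoid of $\mathbb{N}$ generated by $a_1,\dots,a_r$. For $m\ge2$ and $k\ge1$, $$T_{m,k}=\{0,m,2m,\dots,(k-1)m\}\cup\{x\in\mathbb{N}: x\ge km\};$$ thus $T_{m,1}=\langle m,m+1,\dots,2m-1\rangle$ and $T_{m,2}=\langle m,2m+1,\dots,3m-1\rangle$. -}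

module Defs where

open import Data.Empty using (⊥-elim)
open import Data.Integer as ℤ using (ℤ)
open import Data.List using (List; length; filter; upTo)
open import Data.List.Extrema.Nat using (max; xs≤max)
open import Data.List.Membership.Propositional using () renaming (_∈_ to _∈ₗ_)
open import Data.List.Membership.Propositional.Properties
  using (∈-filter⁺; ∈-filter⁻; ∈-upTo⁺)
open import Data.List.Relation.Unary.All using (lookup)
open import Data.List.Relation.Unary.Unique.Propositional using (Unique)
import Data.List.Relation.Unary.Unique.Propositional.Properties as Uniqueₚ
open import Data.Nat using (ℕ; zero; suc; _+_; _*_; _∸_; _≤_; _<_; z≤n; s≤s; _<?_)
open import Data.Nat.Induction using (<-rec)
open import Data.Nat.Properties
open import Data.Product using (∃; ∃-syntax; _×_; _,_; proj₁; proj₂)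
open import Data.Sum using (_⊎_; inj₁; inj₂)
open import Level using (0ℓ)
open import Relation.Binary.PropositionalEquality using (_≡_; refl; sym; subst)
open import Relation.Nullary using (¬_; yes; no; ¬?; _×-dec_)
open import Relation.Nullary.Decidable using (decidable-stable)
open import Relation.Unary using (Pred; Decidable; _∈_; _∉_; _⊆_; _≐_; _∪_; ∁; U)

-- Membership is required to be decidable (automatic classically), so that the
-- invariants below are actual numbers.
record NumericalSemigroup : Set₁ where
  field
    Carrier           : Pred ℕ 0ℓ
    _∈?               : Decidable Carrier
    0∈                : 0 ∈ Carrier
    +-closed          : ∀ {x y} → x ∈ Carrier → y ∈ Carrier → x + y ∈ Carrier
    finite-complement : ∃[ gaps ] (∀ {x} → x ∉ Carrier → x ∈ₗ gaps)

open NumericalSemigroup public using (Carrier)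

Proper : NumericalSemigroup → Set
Proper S = ¬ (Carrier S ≐ U)

data ⟨_⟩ (A : Pred ℕ 0ℓ) : Pred ℕ 0ℓ where
  gen  : ∀ {x} → x ∈ A → x ∈ ⟨ A ⟩
  zero : 0 ∈ ⟨ A ⟩
  add  : ∀ {x y} → x ∈ ⟨ A ⟩ → y ∈ ⟨ A ⟩ → x + y ∈ ⟨ A ⟩

IsMinimalSystem : NumericalSemigroup → Pred ℕ 0ℓ → Set₁
IsMinimalSystem S A =
  ⟨ A ⟩ ≐ Carrier S × (∀ {B : Pred ℕ 0ℓ} → B ⊆ A → ⟨ B ⟩ ≐ Carrier S → A ⊆ B)

IsLeast : Pred ℕ 0ℓ → Pred ℕ 0ℓ
IsLeast P x = x ∈ P × (∀ {y} → y ∈ P → x ≤ y)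

IsGreatest : Pred ℕ 0ℓ → Pred ℕ 0ℓ
IsGreatest P x = x ∈ P × (∀ {y} → y ∈ P → y ≤ x)

private
  least-below : ∀ {P} → Decidable P → ∀ n → ∃ (IsLeast P) ⊎ (∀ {x} → x < n → x ∉ P)
  least-below P? zero = inj₂ λ ()
  least-below {P} P? (suc n) with least-below P? n
  ... | inj₁ l = inj₁ l
  ... | inj₂ none with P? n
  ...   | yes p = inj₁ (n , p , λ q → ≮⇒≥ λ y<n → none y<n q)
  ...   | no ¬p = inj₂ go
    where
    go : ∀ {x} → x < suc n → x ∉ P
    go (s≤s x≤n) q with m≤n⇒m<n∨m≡n x≤n
    ... | inj₁ x<n  = none x<n q
    ... | inj₂ refl = ¬p q

  greatest-below : ∀ {P} → Decidable P → ∀ n → (∀ {x} → x ∈ P → x < n) →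
                   ∃ (IsGreatest P) ⊎ (∀ {x} → x ∉ P)
  greatest-below P? zero bd = inj₂ λ p → n≮0 (bd p)
  greatest-below {P} P? (suc n) bd with P? n
  ... | yes p = inj₁ (n , p , λ q → m<1+n⇒m≤n (bd q))
  ... | no ¬p = greatest-below P? n bd′
    where
    bd′ : ∀ {x} → x ∈ P → x < n
    bd′ q with m≤n⇒m<n∨m≡n (m<1+n⇒m≤n (bd q))
    ... | inj₁ x<n  = x<n
    ... | inj₂ refl = ⊥-elim (¬p q)

module _ (S : NumericalSemigroup) where
  open NumericalSemigroup S hiding (Carrier)

  private
    bound : ℕ
    bound = suc (max 0 (proj₁ finite-complement))

    gap<bound : ∀ {x} → x ∉ Carrier S → x < bound
    gap<bound x∉ = s≤s (lookup (xs≤max 0 _) (proj₂ finite-complement x∉))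

    bound≤⇒∈ : ∀ {x} → bound ≤ x → x ∈ Carrier S
    bound≤⇒∈ {x} b≤x = decidable-stable (x ∈?) λ x∉ → <⇒≱ (gap<bound x∉) b≤x

    Decomposable Primitive : Pred ℕ 0ℓ
    Decomposable x = ∃[ y ] y < x × (0 < y × y ∈ Carrier S × x ∸ y ∈ Carrier S)
    Primitive x = x ∈ Carrier S × 0 < x × ¬ Decomposable x

    decomposable? : Decidable Decomposable
    decomposable? x = anyUpTo? (λ y → (0 <? y) ×-dec (y ∈?) ×-dec ((x ∸ y) ∈?)) x

    primitive? : Decidable Primitive
    primitive? x = (x ∈?) ×-dec (0 <? x) ×-dec ¬? (decomposable? x)

    primitive<2bound : ∀ {x} → Primitive x → x < bound + bound
    primitive<2bound {x} (_ , _ , ¬d) = ≰⇒> λ 2b≤x → ¬d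
      ( bound
      , <-≤-trans (m<m+n bound (s≤s z≤n)) 2b≤x
      , s≤s z≤n
      , bound≤⇒∈ ≤-refl
      , bound≤⇒∈ (subst (_≤ x ∸ bound) (m+n∸n≡m bound bound) (∸-monoˡ-≤ bound 2b≤x)))

    ⟨⟩⊆ : ∀ {A} → A ⊆ Carrier S → ⟨ A ⟩ ⊆ Carrier S
    ⟨⟩⊆ A⊆S (gen a)   = A⊆S a
    ⟨⟩⊆ A⊆S zero      = 0∈
    ⟨⟩⊆ A⊆S (add p q) = +-closed (⟨⟩⊆ A⊆S p) (⟨⟩⊆ A⊆S q)

    primitive∈⟨⟩ : ∀ {B} → ⟨ B ⟩ ⊆ Carrier S → ∀ {x} → Primitive x → x ∈ ⟨ B ⟩ → x ∈ B
    primitive∈⟨⟩ B⊆ p (gen b) = b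
    primitive∈⟨⟩ B⊆ (_ , () , _) zero
    primitive∈⟨⟩ B⊆ p (add {zero} _ r) = primitive∈⟨⟩ B⊆ p r
    primitive∈⟨⟩ {B} B⊆ p (add {suc x} {zero} q _) =
      subst B (sym (+-identityʳ (suc x)))
        (primitive∈⟨⟩ B⊆ (subst Primitive (+-identityʳ (suc x)) p) q)
    primitive∈⟨⟩ B⊆ (_ , _ , ¬d) (add {suc x} {suc y} q r) = ⊥-elim (¬d
      ( suc x
      , m<m+n (suc x) (s≤s z≤n)
      , s≤s z≤n
      , B⊆ q
      , subst (Carrier S) (sym (m+n∸m≡n (suc x) (suc y))) (B⊆ r)))

    primitives : List ℕ
    primitives = filter primitive? (upTo (bound + bound))

    ∈primitives⁺ : ∀ {x} → Primitive x → x ∈ₗ primitives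
    ∈primitives⁺ p = ∈-filter⁺ primitive? (∈-upTo⁺ (primitive<2bound p)) p

    ∈primitives⁻ : ∀ {x} → x ∈ₗ primitives → Primitive x
    ∈primitives⁻ x∈ = proj₂ (∈-filter⁻ primitive? {xs = upTo (bound + bound)} x∈)

    S⊆⟨primitives⟩ : Carrier S ⊆ ⟨ _∈ₗ primitives ⟩
    S⊆⟨primitives⟩ {x} = <-rec (λ x → x ∈ Carrier S → x ∈ ⟨ _∈ₗ primitives ⟩) step x
      where
      step : ∀ x → (∀ {y} → y < x → y ∈ Carrier S → y ∈ ⟨ _∈ₗ primitives ⟩) →
             x ∈ Carrier S → x ∈ ⟨ _∈ₗ primitives ⟩
      step zero _ _ = zero
      step x@(suc _) rec x∈ with decomposable? x
      ... | no ¬d = gen (∈primitives⁺ (x∈ , s≤s z≤n , ¬d))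
      ... | yes (y@(suc _) , y<x , 0<y , y∈ , x∸y∈) =
        subst ⟨ _∈ₗ primitives ⟩ (m+[n∸m]≡n (<⇒≤ y<x))
          (add (rec y<x y∈) (rec (∸-monoʳ-< 0<y (<⇒≤ y<x)) x∸y∈))

  minimalSystem : ∃[ as ] Unique as × IsMinimalSystem S (_∈ₗ as)
  minimalSystem =
      primitives
    , Uniqueₚ.filter⁺ primitive? (Uniqueₚ.upTo⁺ (bound + bound))
    , (⟨⟩⊆ (λ x∈ → proj₁ (∈primitives⁻ x∈)) , S⊆⟨primitives⟩)
    , λ _ (⟨B⟩⊆S , S⊆⟨B⟩) x∈ → let p = ∈primitives⁻ x∈ in
        primitive∈⟨⟩ ⟨B⟩⊆S p (S⊆⟨B⟩ (proj₁ p))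

  minimalSystem-unique : ∀ {A} → IsMinimalSystem S A → A ≐ (_∈ₗ proj₁ minimalSystem)
  minimalSystem-unique {A} ((⟨A⟩⊆S , S⊆⟨A⟩) , minimal) =
    minimal primitives⊆A (proj₁ (proj₂ (proj₂ minimalSystem))) , primitives⊆A
    where
    primitives⊆A : (_∈ₗ primitives) ⊆ A
    primitives⊆A x∈ = let p = ∈primitives⁻ x∈ in primitive∈⟨⟩ ⟨A⟩⊆S p (S⊆⟨A⟩ (proj₁ p))

  embeddingDimension : ℕ
  embeddingDimension = length (proj₁ minimalSystem)

  leastPositive : ∃ (IsLeast (λ x → x ∈ Carrier S × 0 < x))
  leastPositive with least-below (λ x → (x ∈?) ×-dec (0 <? x)) (suc bound)
  ... | inj₁ l    = l
  ... | inj₂ none = ⊥-elim (none ≤-refl (bound≤⇒∈ ≤-refl , s≤s z≤n))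

  multiplicity : ℕ
  multiplicity = proj₁ leastPositive

  module _ (S≢ℕ : Proper S) where

    greatestGap : ∃ (IsGreatest (∁ (Carrier S)))
    greatestGap with greatest-below (λ x → ¬? (x ∈?)) bound gap<bound
    ... | inj₁ g    = g
    ... | inj₂ none =
      ⊥-elim (S≢ℕ ((λ _ → _) , λ {x} _ → decidable-stable (x ∈?) none))

    frobenius : ℕ
    frobenius = proj₁ greatestGap

    conductor : ℕ
    conductor = suc frobenius

    -- n(S) = |S ∩ [0 , c(S))|
    leftCount : ℕ
    leftCount = length (filter _∈? (upTo conductor))

    wilfNumber : ℤ
    wilfNumber = ℤ.+ (embeddingDimension * leftCount) ℤ.- ℤ.+ conductor

T : ℕ → ℕ → Pred ℕ 0ℓ
T m k = (λ x → ∃[ i ] i < k × x ≡ i * m) ∪ (k * m ≤_)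

{-# OPTIONS --safe #-}

-- Let L be the set of nonzero elements of S below c = c(S), let m = m(S) and l = |L|.
-- The minimal generators of S lie in L ∪ [c , c + m), and as c ≤ 2m the elements of
-- this set which are not minimal generators are the members of L + L below c + m.
-- If there are d of them, then e(S) = l + m − d, where d ≤ t = l(l+1)/2 and
-- d ≤ q = c − m ≤ m.  Writing m = q + i, q = d + j and t = d + k one finds
--   W(S) = 2k + (l − 1)j + l i,
-- so for l ≥ 2 the Wilf number vanishes only if i = j = k = 0, that is, if the sums of
-- two elements of L are pairwise distinct and fill [2m , 3m).  Then m, m + 1 ∈ L, and
-- the sums 3m − 1 and 3m − 2 must be (w + 1) + (w + 1) and w + (w + 1) with
-- w, w + 1 ∈ L.  Since m + (w + 1) = (m + 1) + w, distinctness forces w = m, so m = 3.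
module Submission where

open import Defs
open import Data.Empty using (⊥-elim)
open import Data.Integer using (0ℤ)
import Data.Integer.Properties as ℤ
open import Data.List using (List; []; _∷_; _++_; length; map; filter; upTo; applyUpTo)
open import Data.List.Properties using (length-++; length-map; length-applyUpTo; ++-identityʳ)
open import Data.List.Membership.Propositional using () renaming (_∈_ to _∈ₗ_)
open import Data.List.Membership.Propositional.Properties
  using (∈-∃++; ∈-map⁺; ∈-map⁻; ∈-++⁺ˡ; ∈-++⁺ʳ; ∈-++⁻; ∈-filter⁺; ∈-filter⁻;
         ∈-upTo⁺; ∈-upTo⁻; ∈-applyUpTo⁺; ∈-applyUpTo⁻)
open import Data.List.Relation.Binary.Permutation.Propositional
  using (_↭_; prep; ↭-refl; ↭-sym; ↭-trans; ↭⇒↭ₛ)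
open import Data.List.Relation.Binary.Permutation.Propositional.Properties
  using (∈-resp-↭; ↭-length; shift)
import Data.List.Relation.Binary.Permutation.Setoid.Properties as Permₛ
open import Data.List.Relation.Unary.All as All using ([]; _∷_)
open import Data.List.Relation.Unary.AllPairs using ([]; _∷_)
open import Data.List.Relation.Unary.Any using (here; there)
open import Data.List.Relation.Unary.Unique.Propositional using (Unique)
import Data.List.Relation.Unary.Unique.Propositional.Properties as Unique
open import Data.Nat using (ℕ; zero; suc; _+_; _*_; _∸_; _≤_; _<_; z≤n; s≤s; z<s; _≟_; _<?_)
open import Data.Nat.Properties
open import Data.Nat.Tactic.RingSolver using (solve-∀)
open import Data.Product using (∃-syntax; ∃₂; _×_; _,_; proj₁; proj₂)
open import Data.Sum using (_⊎_; inj₁; inj₂; [_,_]′)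
open import Function using (_∘_)
open import Function.Bundles using (_⇔_; mk⇔)
open import Level using (0ℓ)
open import Relation.Binary.PropositionalEquality
open import Relation.Nullary using (¬_; yes; no)
open import Relation.Nullary.Decidable using (decidable-stable)
open import Relation.Unary using (Pred; _≐_)

-- Lists without repetition as finite sets

module _ {A : Set} where

  Unique-resp-↭ : {xs ys : List A} → xs ↭ ys → Unique xs → Unique ys
  Unique-resp-↭ xs↭ys = Permₛ.Unique-resp-↭ (setoid A) (↭⇒↭ₛ xs↭ys)

  Unique-++⁻ʳ : ∀ xs {ys : List A} → Unique (xs ++ ys) → Unique ys
  Unique-++⁻ʳ []       u       = u
  Unique-++⁻ʳ (x ∷ xs) (_ ∷ u) = Unique-++⁻ʳ xs u

  Unique-++⇒disjoint : ∀ {xs ys : List A} {v} → Unique (xs ++ ys) → v ∈ₗ xs → ¬ v ∈ₗ ys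
  Unique-++⇒disjoint {x ∷ xs} (x≢ ∷ _) (here refl) v∈ys = All.lookup x≢ (∈-++⁺ʳ xs v∈ys) refl
  Unique-++⇒disjoint {x ∷ xs} (_ ∷ u)  (there v∈xs) v∈ys = Unique-++⇒disjoint u v∈xs v∈ys

  ∈-∷⁻ : ∀ {x v} {xs : List A} → x ≢ v → v ∈ₗ x ∷ xs → v ∈ₗ xs
  ∈-∷⁻ x≢v (here refl)  = ⊥-elim (x≢v refl)
  ∈-∷⁻ x≢v (there v∈xs) = v∈xs

  -- The witness `zs` is the complement of `xs` in `ys`, found by deleting the members of `xs` from
  -- `ys` one at a time. Its length serves as the slack in every cardinality comparison below, which
  -- turns inequalities into equations.
  Unique-⊆⇒↭ : ∀ {xs ys : List A} → Unique xs → (∀ {v} → v ∈ₗ xs → v ∈ₗ ys) →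
               ∃[ zs ] ys ↭ xs ++ zs
  Unique-⊆⇒↭ {[]}     {ys} _ _ = ys , ↭-refl
  Unique-⊆⇒↭ {x ∷ xs} {ys} (x≢ ∷ u) xs⊆ys
    with ps , qs , refl ← ∈-∃++ (xs⊆ys (here refl))
    with zs , eq ← Unique-⊆⇒↭ {xs} {ps ++ qs} u (λ v∈xs →
           ∈-∷⁻ (All.lookup x≢ v∈xs) (∈-resp-↭ (shift x ps qs) (xs⊆ys (there v∈xs))))
    = zs , ↭-trans (shift x ps qs) (prep x eq)

  length[↭++] : ∀ xs {ys zs : List A} → ys ↭ xs ++ zs → length ys ≡ length xs + length zs
  length[↭++] xs p = trans (↭-length p) (length-++ xs)

  Unique-⊆⇒length≤ : ∀ {xs ys : List A} → Unique xs → (∀ {v} → v ∈ₗ xs → v ∈ₗ ys) →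
                     length xs ≤ length ys
  Unique-⊆⇒length≤ {xs} u xs⊆ys with zs , p ← Unique-⊆⇒↭ u xs⊆ys =
    subst (length xs ≤_) (sym (length[↭++] xs p)) (m≤m+n _ _)

  ↭++-empty : ∀ {xs ys zs : List A} → ys ↭ xs ++ zs → length zs ≡ 0 → ys ↭ xs
  ↭++-empty {xs} {ys} {[]} p _ = subst (ys ↭_) (++-identityʳ xs) p

  -- The complement of `xs` in `ys` is empty, because the two inclusions bound each length by the
  -- other.
  Unique-≐⇒↭ : ∀ {xs ys : List A} → Unique xs → Unique ys →
               (∀ {v} → v ∈ₗ xs → v ∈ₗ ys) → (∀ {v} → v ∈ₗ ys → v ∈ₗ xs) → ys ↭ xs
  Unique-≐⇒↭ {xs} {ys} uxs uys xs⊆ys ys⊆xs with zs , p ← Unique-⊆⇒↭ uxs xs⊆ys =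
    ↭++-empty p (n≤0⇒n≡0 (+-cancelˡ-≤ (length xs) _ _ (begin
      length xs + length zs ≡⟨ length[↭++] xs p ⟨
      length ys             ≤⟨ Unique-⊆⇒length≤ uys ys⊆xs ⟩
      length xs             ≡⟨ +-identityʳ _ ⟨
      length xs + 0         ∎)))
    where open ≤-Reasoning

-- Intervals, lists of pairwise sums, and the arithmetic of the Wilf number

interval : ℕ → ℕ → List ℕ
interval a n = applyUpTo (a +_) n

∈-interval⁺ : ∀ {a n x} → a ≤ x → x < a + n → x ∈ₗ interval a n
∈-interval⁺ {a} {n} {x} a≤x x<a+n =
  subst (_∈ₗ interval a n) (m+[n∸m]≡n a≤x)
    (∈-applyUpTo⁺ (a +_) (+-cancelˡ-< a _ _ (subst (_< a + n) (sym (m+[n∸m]≡n a≤x)) x<a+n)))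

∈-interval⁻ : ∀ {a n x} → x ∈ₗ interval a n → a ≤ x × x < a + n
∈-interval⁻ {a} x∈ with i , i<n , refl ← ∈-applyUpTo⁻ (a +_) x∈ = m≤m+n a i , +-monoʳ-< a i<n

interval-unique : ∀ a n → Unique (interval a n)
interval-unique a n = Unique.applyUpTo⁺₁ (a +_) n λ i<j _ eq → <⇒≢ i<j (+-cancelˡ-≡ a _ _ eq)

-- Each unordered pair of positions, equal positions included, contributes one entry, so the length
-- is `l(l+1)/2` and a coincidence between two sums appears as a repeated entry.
sums : List ℕ → List ℕ
sums []       = []
sums (x ∷ xs) = map (x +_) (x ∷ xs) ++ sums xs

∈-sums⁺ : ∀ {xs a b} → a ∈ₗ xs → b ∈ₗ xs → a + b ∈ₗ sums xs
∈-sums⁺ {x ∷ xs} (here refl) b∈ = ∈-++⁺ˡ (∈-map⁺ (x +_) b∈)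
∈-sums⁺ {x ∷ xs} {a} (there a∈) (here refl) =
  subst (_∈ₗ sums (x ∷ xs)) (+-comm x a) (∈-++⁺ˡ (∈-map⁺ (x +_) (there a∈)))
∈-sums⁺ {x ∷ xs} (there a∈) (there b∈) = ∈-++⁺ʳ (map (x +_) (x ∷ xs)) (∈-sums⁺ a∈ b∈)

∈-sums⁻ : ∀ {xs v} → v ∈ₗ sums xs → ∃₂ λ a b → a ∈ₗ xs × b ∈ₗ xs × v ≡ a + b
∈-sums⁻ {x ∷ xs} v∈ with ∈-++⁻ (map (x +_) (x ∷ xs)) v∈
... | inj₁ v∈map with b , b∈ , eq ← ∈-map⁻ (x +_) v∈map = x , b , here refl , b∈ , eq
... | inj₂ v∈sums with a , b , a∈ , b∈ , eq ← ∈-sums⁻ {xs} v∈sums =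
  a , b , there a∈ , there b∈ , eq

length-sums : ∀ xs → 2 * length (sums xs) ≡ length xs * suc (length xs)
length-sums []       = refl
length-sums (x ∷ xs) = begin
  2 * length (sums (x ∷ xs))
    ≡⟨ cong (2 *_) (length-++ (map (x +_) (x ∷ xs))) ⟩
  2 * (length (map (x +_) (x ∷ xs)) + length (sums xs))
    ≡⟨ cong (λ z → 2 * (z + length (sums xs))) (length-map (x +_) (x ∷ xs)) ⟩
  2 * (suc (length xs) + length (sums xs))
    ≡⟨ *-distribˡ-+ 2 (suc (length xs)) (length (sums xs)) ⟩
  2 * suc (length xs) + 2 * length (sums xs)
    ≡⟨ cong (2 * suc (length xs) +_) (length-sums xs) ⟩
  2 * suc (length xs) + length xs * suc (length xs)
    ≡⟨ *-distribʳ-+ (suc (length xs)) 2 (length xs) ⟨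
  suc (suc (length xs)) * suc (length xs)
    ≡⟨ *-comm (suc (suc (length xs))) (suc (length xs)) ⟩
  suc (length xs) * suc (suc (length xs)) ∎
  where open ≡-Reasoning

-- W(S) = 2k + (l − 1)j + l i, with both sides moved so that no subtraction occurs.
wilf-identity : ∀ {l e d i j k} → l + (d + j + i) ≡ e + d → 2 * (d + k) ≡ l * suc l →
  suc l * e + 2 * j ≡ (d + j + i) + (d + j) + (2 * k + suc l * j + l * i)
wilf-identity {l} {e} {d} {i} {j} {k} e+d 2t = begin
    suc l * e + 2 * j                             ≡⟨ cong (λ z → suc l * z + 2 * j) e≡ ⟩
    suc l * (l + j + i) + 2 * j                   ≡⟨ expand l i j ⟩
    l * suc l + (suc l * j + suc l * i + 2 * j)   ≡⟨ cong (_+ (suc l * j + suc l * i + 2 * j)) 2t ⟨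
    2 * (d + k) + (suc l * j + suc l * i + 2 * j) ≡⟨ collect l d i j k ⟩
    (d + j + i) + (d + j) + (2 * k + suc l * j + l * i) ∎
  where
  open ≡-Reasoning
  rearrange : ∀ l d j i → l + (d + j + i) ≡ l + j + i + d
  rearrange = solve-∀
  e≡ : e ≡ l + j + i
  e≡ = +-cancelʳ-≡ d e (l + j + i) (trans (sym e+d) (rearrange l d j i))
  expand : ∀ l i j → suc l * (l + j + i) + 2 * j ≡ l * suc l + (suc l * j + suc l * i + 2 * j)
  expand = solve-∀
  collect : ∀ l d i j k → 2 * (d + k) + (suc l * j + suc l * i + 2 * j) ≡
            (d + j + i) + (d + j) + (2 * k + suc l * j + l * i)
  collect = solve-∀

-- Here `l` stands for one less than the number of nonzero small elements. Cancelling `2 * j` leaves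
-- `2 * k + l * j + suc l * i ≡ 0`, a sum of naturals, so every term vanishes.
wilf-zero : ∀ {l i j k} → 2 * j ≡ 2 * k + suc (suc l) * j + suc l * i →
            i ≡ 0 × k ≡ 0 × (l ≡ 0 ⊎ j ≡ 0)
wilf-zero {l} {i} {j} {k} eq =
    m+n≡0⇒m≡0 i (m+n≡0⇒n≡0 (2 * k + l * j) rest)
  , m+n≡0⇒m≡0 k (m+n≡0⇒m≡0 (2 * k) (m+n≡0⇒m≡0 (2 * k + l * j) rest))
  , m*n≡0⇒m≡0∨n≡0 l (m+n≡0⇒n≡0 (2 * k) (m+n≡0⇒m≡0 (2 * k + l * j) rest))
  where
  regroup : ∀ l i j k → 2 * k + suc (suc l) * j + suc l * i ≡ 2 * j + (2 * k + l * j + suc l * i)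
  regroup = solve-∀
  rest : 2 * k + l * j + suc l * i ≡ 0
  rest = +-cancelˡ-≡ (2 * j) _ _
    (trans (sym (regroup l i j k)) (trans (sym eq) (sym (+-identityʳ (2 * j)))))

-- Submonoids generated by a set

⟨⟩-bind : ∀ {A B : Pred ℕ 0ℓ} → (∀ {x} → A x → ⟨ B ⟩ x) → ∀ {x} → ⟨ A ⟩ x → ⟨ B ⟩ x
⟨⟩-bind f (gen a)   = f a
⟨⟩-bind f zero      = zero
⟨⟩-bind f (add p q) = add (⟨⟩-bind f p) (⟨⟩-bind f q)

-- A derivation may contain `add` with a zero summand. The recursion strips these, so that a
-- decomposition has two positive parts.
∈⟨⟩-cases : ∀ {A x} → ⟨ A ⟩ x →
  A x ⊎ x ≡ 0 ⊎ ∃₂ λ y z → 0 < y × 0 < z × ⟨ A ⟩ y × ⟨ A ⟩ z × x ≡ y + z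
∈⟨⟩-cases (gen a) = inj₁ a
∈⟨⟩-cases zero    = inj₂ (inj₁ refl)
∈⟨⟩-cases (add {zero} p q) = ∈⟨⟩-cases q
∈⟨⟩-cases {A} (add {suc y} {zero} p q) =
  subst (λ v → A v ⊎ v ≡ 0 ⊎ ∃₂ λ y z → 0 < y × 0 < z × ⟨ A ⟩ y × ⟨ A ⟩ z × v ≡ y + z)
    (sym (+-identityʳ (suc y))) (∈⟨⟩-cases p)
∈⟨⟩-cases (add {suc y} {suc z} p q) = inj₂ (inj₂ (suc y , suc z , z<s , z<s , p , q , refl))

-- Lists whose pairwise sums are distinct and fill [2m , 3m)

double-≤ : ∀ {x y} → x + x ≤ y + y → x ≤ y
double-≤ p = ≮⇒≥ λ y<x → <⇒≱ (+-mono-< y<x y<x) p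

-- If both summands exceeded `m`, the sum would be at least `2m + 2`.
+≡1+double : ∀ {m a b} → m ≤ a → m ≤ b → a + b ≡ suc (m + m) → a ≡ suc m ⊎ b ≡ suc m
+≡1+double {m} {a} {b} m≤a m≤b eq with m≤n⇒m<n∨m≡n m≤a | m≤n⇒m<n∨m≡n m≤b
... | inj₂ refl | _ = inj₂ (+-cancelˡ-≡ m b (suc m) (trans eq (sym (+-suc m m))))
... | inj₁ _ | inj₂ refl = inj₁ (+-cancelʳ-≡ m a (suc m) eq)
... | inj₁ m<a | inj₁ m<b =
  ⊥-elim (1+n≰n (subst₂ _≤_ (cong suc (+-suc m m)) eq (+-mono-≤ m<a m<b)))

-- If both summands were below `M`, their sum would be at most `2M - 2`, whereas it is `2M - 1`.
1++≡double : ∀ {M a b} → a ≤ M → b ≤ M → suc (a + b) ≡ M + M →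
             (a ≡ M × suc b ≡ M) ⊎ (suc a ≡ M × b ≡ M)
1++≡double {M} {a} {b} a≤M b≤M eq with m≤n⇒m<n∨m≡n a≤M | m≤n⇒m<n∨m≡n b≤M
... | inj₂ refl | _ = inj₁ (refl , +-cancelˡ-≡ a (suc b) a (trans (+-suc a b) eq))
... | inj₁ _ | inj₂ refl = inj₂ (+-cancelʳ-≡ b (suc a) b eq , refl)
... | inj₁ a<M | inj₁ b<M =
  ⊥-elim (1+n≰n (subst₂ _≤_ (cong suc (+-suc a b)) (sym eq) (+-mono-≤ a<M b<M)))

module _ {m : ℕ} (L : List ℕ) (sums↭ : sums L ↭ interval (m + m) m) where

  length-sums-interval : 2 * m ≡ length L * suc (length L)
  length-sums-interval = trans
    (cong (2 *_) (sym (trans (↭-length sums↭) (length-applyUpTo (m + m +_) m)))) (length-sums L)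

  sums-interval⇒3≤ : 2 ≤ length L → 3 ≤ m
  sums-interval⇒3≤ 2≤l = *-cancelˡ-≤ 2
    (subst (6 ≤_) (sym length-sums-interval) (*-mono-≤ 2≤l (s≤s 2≤l)))

  ∈-sums-interval : ∀ {x} → m + m ≤ x → x < m + m + m → ∃₂ λ a b → a ∈ₗ L × b ∈ₗ L × x ≡ a + b
  ∈-sums-interval 2m≤x x<3m = ∈-sums⁻ {L} (∈-resp-↭ (↭-sym sums↭) (∈-interval⁺ 2m≤x x<3m))

  -- The number `2m + 1` lies in the interval, hence is a sum of two members of `L`; both are at
  -- least `m`, so one of them is `m + 1`.
  sums-interval⇒1+m∈ : 2 ≤ length L → (∀ {x} → x ∈ₗ L → m ≤ x) → suc m ∈ₗ L
  sums-interval⇒1+m∈ 2≤l m≤ with a , b , a∈ , b∈ , eq ← ∈-sums-interval (n≤1+n (m + m))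
      (subst (_≤ m + m + m) (+-comm (m + m) 2)
        (+-monoʳ-≤ (m + m) (≤-trans (n≤1+n 2) (sums-interval⇒3≤ 2≤l))))
    with +≡1+double (m≤ a∈) (m≤ b∈) (sym eq)
  ... | inj₁ refl = a∈
  ... | inj₂ refl = b∈

  -- Write `3m - 1 = a + b` and `3m - 2 = a′ + b′` with summands in `L`. No double `x + x` exceeds
  -- `3m - 1`, so `a = b` is the maximum of `L`. Then `a′ + b′ = 2a - 1` forces one of `a′`, `b′` to
  -- be `a - 1`, which is the witness `w`.
  sums-interval⇒top : 3 ≤ m → ∃[ w ] w ∈ₗ L × suc w ∈ₗ L × suc (suc w + suc w) ≡ m + m + m
  -- Now `m` is `3 + r`, so the offsets `suc (suc r)` and `suc r` from `m + m` give `3m - 1` and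
  -- `3m - 2`.
  sums-interval⇒top (s≤s (s≤s (s≤s {n = r} z≤n)))
    with a , b , a∈ , b∈ , top≡ ← ∈-sums-interval {m + m + suc (suc r)}
           (m≤m+n (m + m) _) (+-monoʳ-< (m + m) (n<1+n _))
       | a′ , b′ , a′∈ , b′∈ , next≡ ← ∈-sums-interval {m + m + suc r}
           (m≤m+n (m + m) _) (+-monoʳ-< (m + m) (m<n⇒m<1+n (n<1+n _)))
    = finish (1++≡double (≤a a′∈) (≤a b′∈) (trans (cong suc (sym next≡)) 1+next≡a+a))
    where
    top : ℕ
    top = m + m + suc (suc r)
    1+top : suc top ≡ m + m + m
    1+top = sym (+-suc (m + m) (suc (suc r)))
    +≤top : ∀ {x} → x ∈ₗ L → x + x ≤ top
    +≤top {x} x∈ = m<1+n⇒m≤n (subst (x + x <_) (sym 1+top)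
      (proj₂ (∈-interval⁻ (∈-resp-↭ sums↭ (∈-sums⁺ x∈ x∈)))))
    a≡b : a ≡ b
    a≡b = ≤-antisym (+-cancelˡ-≤ a a b (subst (a + a ≤_) top≡ (+≤top a∈)))
                    (+-cancelʳ-≤ b b a (subst (b + b ≤_) top≡ (+≤top b∈)))
    top≡a+a : top ≡ a + a
    top≡a+a = trans top≡ (cong (a +_) (sym a≡b))
    ≤a : ∀ {x} → x ∈ₗ L → x ≤ a
    ≤a {x} x∈ = double-≤ (subst (x + x ≤_) top≡a+a (+≤top x∈))
    1+next≡a+a : suc (m + m + suc r) ≡ a + a
    1+next≡a+a = trans (sym (+-suc (m + m) (suc r))) top≡a+a
    result : ∀ {w} → w ∈ₗ L → suc w ≡ a →
             ∃[ w ] w ∈ₗ L × suc w ∈ₗ L × suc (suc w + suc w) ≡ m + m + m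
    result {w} w∈ refl = w , w∈ , a∈ , trans (cong suc (sym top≡a+a)) 1+top
    finish : (a′ ≡ a × suc b′ ≡ a) ⊎ (suc a′ ≡ a × b′ ≡ a) →
             ∃[ w ] w ∈ₗ L × suc w ∈ₗ L × suc (suc w + suc w) ≡ m + m + m
    finish (inj₁ (_ , eq)) = result b′∈ eq
    finish (inj₂ (eq , _)) = result a′∈ eq

sums-interval⇒3,4 : ∀ {m K} → sums (m ∷ suc m ∷ K) ↭ interval (m + m) m → m ≡ 3 × K ≡ []
sums-interval⇒3,4 {m} {K} sums↭ = m≡3 , K≡[] K refl
  where
  L : List ℕ
  L = m ∷ suc m ∷ K
  top⇒m≡3 : (∃[ w ] w ∈ₗ L × suc w ∈ₗ L × suc (suc w + suc w) ≡ m + m + m) → m ≡ 3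
  -- For `w = m` the equation reads `2(m + 1) + 1 = 3m`.
  top⇒m≡3 (_ , here refl , _ , eq) = sym (+-cancelˡ-≡ (m + m) 3 m (trans (rearrange m) eq))
    where
    rearrange : ∀ m → m + m + 3 ≡ suc (suc m + suc m)
    rearrange = solve-∀
  -- Otherwise `m + suc w` in the first block of `sums L` and `suc m + w` in the remaining blocks
  -- are equal entries, although `sums L` has no repetition.
  top⇒m≡3 (w , there w∈ , 1+w∈ , _) = ⊥-elim (Unique-++⇒disjoint
    (Unique-resp-↭ (↭-sym sums↭) (interval-unique (m + m) m))
    (∈-map⁺ (m +_) 1+w∈)
    (subst (_∈ₗ sums (suc m ∷ K)) (sym (+-suc m w)) (∈-sums⁺ {suc m ∷ K} (here refl) w∈)))
  m≡3 : m ≡ 3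
  m≡3 = top⇒m≡3 (sums-interval⇒top L sums↭ (sums-interval⇒3≤ L sums↭ (s≤s (s≤s z≤n))))
  K≡[] : ∀ K′ → K ≡ K′ → K ≡ []
  K≡[] []       eq   = eq
  -- A third member of `L` would make `l(l+1)` at least 12, but it equals `2m = 6`.
  K≡[] (x ∷ K′) refl = ⊥-elim (<⇒≱ (m≤n+m 7 5) (begin
    12                              ≤⟨ *-mono-≤ (m≤m+n 3 (length K′)) (m≤m+n 4 (length K′)) ⟩
    length L * suc (length L)       ≡⟨ length-sums-interval L sums↭ ⟨
    2 * m                           ≡⟨ cong (2 *_) m≡3 ⟩
    6                               ∎))
    where open ≤-Reasoning

-- The semigroup ⟨3 , 4⟩

private
  ⟨3,4⟩ : Pred ℕ 0ℓ
  ⟨3,4⟩ = ⟨ (λ x → x ∈ₗ (3 ∷ 4 ∷ [])) ⟩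

3∈⟨3,4⟩ : ⟨3,4⟩ 3
3∈⟨3,4⟩ = gen (here refl)

4∈⟨3,4⟩ : ⟨3,4⟩ 4
4∈⟨3,4⟩ = gen (there (here refl))

6+∈⟨3,4⟩ : ∀ y → ⟨3,4⟩ (6 + y)
6+∈⟨3,4⟩ 0 = add 3∈⟨3,4⟩ 3∈⟨3,4⟩
6+∈⟨3,4⟩ 1 = add 3∈⟨3,4⟩ 4∈⟨3,4⟩
6+∈⟨3,4⟩ 2 = add 4∈⟨3,4⟩ 4∈⟨3,4⟩
6+∈⟨3,4⟩ (suc (suc (suc y))) = add 3∈⟨3,4⟩ (6+∈⟨3,4⟩ y)

6≤⇒∈⟨3,4⟩ : ∀ {x} → 6 ≤ x → ⟨3,4⟩ x
6≤⇒∈⟨3,4⟩ 6≤x = subst ⟨3,4⟩ (m+[n∸m]≡n 6≤x) (6+∈⟨3,4⟩ _)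

∈⟨3,4⟩⇒3≤ : ∀ {x} → ⟨3,4⟩ x → 0 < x → 3 ≤ x
∈⟨3,4⟩⇒3≤ (gen (here refl)) _ = ≤-refl
∈⟨3,4⟩⇒3≤ (gen (there (here refl))) _ = n≤1+n 3
∈⟨3,4⟩⇒3≤ (add {zero} p q) 0<x = ∈⟨3,4⟩⇒3≤ q 0<x
∈⟨3,4⟩⇒3≤ (add {suc y} {z} p q) _ = ≤-trans (∈⟨3,4⟩⇒3≤ p z<s) (m≤m+n (suc y) z)

-- A sum of two positive elements is at least `3 + 3`; anything else is 0 or a generator.
∈⟨3,4⟩-cases : ∀ {x} → ⟨3,4⟩ x → x ∈ₗ (0 ∷ 3 ∷ 4 ∷ []) ⊎ 6 ≤ x
∈⟨3,4⟩-cases p with ∈⟨⟩-cases p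
... | inj₁ x∈          = inj₁ (there x∈)
... | inj₂ (inj₁ refl) = inj₁ (here refl)
... | inj₂ (inj₂ (y , z , 0<y , 0<z , q , r , refl)) =
  inj₂ (+-mono-≤ (∈⟨3,4⟩⇒3≤ q 0<y) (∈⟨3,4⟩⇒3≤ r 0<z))

-- The semigroups T m k

∈T : ∀ {a k} → 0 < k → T a k a
∈T {a} {1}           _ = inj₂ (≤-reflexive (*-identityˡ a))
∈T {a} {suc (suc k)} _ = inj₁ (1 , s≤s (s≤s z≤n) , sym (*-identityˡ a))

∈T⇒≤ : ∀ {a k x} → 0 < k → T a k x → 0 < x → a ≤ x
∈T⇒≤         _ (inj₁ (zero  , _ , refl)) ()
∈T⇒≤ {a}     _ (inj₁ (suc i , _ , refl)) _ = m≤m+n a (i * a)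
∈T⇒≤ {a} {suc k} _ (inj₂ ka≤x) _ = ≤-trans (m≤m+n a (k * a)) ka≤x

-- Minimal generators and sums of two small elements

module _
  (S : NumericalSemigroup)
  {gens : List ℕ} (gens-unique : Unique gens) (gens-minimal : IsMinimalSystem S (_∈ₗ gens))
  where

  open NumericalSemigroup S using (+-closed)

  private
    ⟨gens⟩⊆S : ∀ {x} → ⟨ _∈ₗ gens ⟩ x → Carrier S x
    ⟨gens⟩⊆S = proj₁ (proj₁ gens-minimal)

    S⊆⟨gens⟩ : ∀ {x} → Carrier S x → ⟨ _∈ₗ gens ⟩ x
    S⊆⟨gens⟩ = proj₂ (proj₁ gens-minimal)

  gens⊆S : ∀ {x} → x ∈ₗ gens → Carrier S x
  gens⊆S x∈ = ⟨gens⟩⊆S (gen x∈)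

  -- If the other generators produce `x`, then they still generate `S`. Minimality would place `x`
  -- among the generators different from `x`.
  ∈⟨gens∖⟩⇒∉gens : ∀ {x} → ⟨ (λ v → v ∈ₗ gens × v ≢ x) ⟩ x → ¬ (x ∈ₗ gens)
  ∈⟨gens∖⟩⇒∉gens {x} x∈⟨B⟩ x∈gens =
    proj₂ (proj₂ gens-minimal proj₁
      (⟨gens⟩⊆S ∘ ⟨⟩-bind (gen ∘ proj₁) , ⟨⟩-bind gen′ ∘ S⊆⟨gens⟩) x∈gens) refl
    where
    gen′ : ∀ {v} → v ∈ₗ gens → ⟨ (λ v → v ∈ₗ gens × v ≢ x) ⟩ v
    gen′ {v} v∈ with v ≟ x
    ... | yes refl = x∈⟨B⟩
    ... | no  v≢x  = gen (v∈ , v≢x)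

  gens>0 : ∀ {x} → x ∈ₗ gens → 0 < x
  gens>0 x∈ = n≢0⇒n>0 λ { refl → ∈⟨gens∖⟩⇒∉gens zero x∈ }

  -- Both summands are smaller than `x + y`, so their derivations use only generators other than
  -- `x + y`. With `∉gens⇒+` this makes the generators exactly the irreducible positive elements.
  gens∌+ : ∀ {x y} → Carrier S x → Carrier S y → 0 < x → 0 < y → ¬ (x + y ∈ₗ gens)
  gens∌+ {x} {y} x∈ y∈ 0<x 0<y =
    ∈⟨gens∖⟩⇒∉gens (add (below (S⊆⟨gens⟩ x∈) (m<m+n x 0<y)) (below (S⊆⟨gens⟩ y∈) (m<n+m y 0<x)))
    where
    below : ∀ {v} → ⟨ _∈ₗ gens ⟩ v → v < x + y → ⟨ (λ w → w ∈ₗ gens × w ≢ x + y) ⟩ v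
    below (gen v∈)  v< = gen (v∈ , <⇒≢ v<)
    below zero      _  = zero
    below (add {u} {v} p q) u+v< =
      add (below p (≤-<-trans (m≤m+n u v) u+v<)) (below q (≤-<-trans (m≤n+m v u) u+v<))

  ∉gens⇒+ : ∀ {x} → Carrier S x → 0 < x → ¬ (x ∈ₗ gens) →
            ∃₂ λ y z → 0 < y × 0 < z × Carrier S y × Carrier S z × x ≡ y + z
  ∉gens⇒+ x∈ 0<x x∉ with ∈⟨⟩-cases (S⊆⟨gens⟩ x∈)
  ... | inj₁ p           = ⊥-elim (x∉ p)
  ... | inj₂ (inj₁ refl) = ⊥-elim (n≮0 0<x)
  ... | inj₂ (inj₂ (y , z , 0<y , 0<z , p , q , eq)) =
    y , z , 0<y , 0<z , ⟨gens⟩⊆S p , ⟨gens⟩⊆S q , eq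

  -- Counting minimal generators when the conductor is at most twice the multiplicity

  module Count
    {m c : ℕ} (m∈ : Carrier S m) (0<m : 0 < m)
    (m≤ : ∀ {x} → Carrier S x → 0 < x → m ≤ x)
    (0<c : 0 < c) (c≤⇒∈ : ∀ {x} → c ≤ x → Carrier S x) (c≤2m : c ≤ 2 * m)
    {L : List ℕ} (L-unique : Unique L)
    (∈L⁺ : ∀ {x} → Carrier S x → 0 < x → x < c → x ∈ₗ L)
    (∈L⁻ : ∀ {x} → x ∈ₗ L → Carrier S x × 0 < x × x < c)
    where

    private
      e l t q : ℕ
      e = length gens
      l = length L
      t = length (sums L)
      q = c ∸ m

      c≡m+q : c ≡ m + q
      c≡m+q = sym (m+[n∸m]≡n (m≤ (c≤⇒∈ ≤-refl) 0<c))

      q≤m : q ≤ m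
      q≤m = m≤n+o⇒m∸n≤o c m (subst (c ≤_) (cong (m +_) (+-identityʳ m)) c≤2m)

    ∈L⇒m≤ : ∀ {x} → x ∈ₗ L → m ≤ x
    ∈L⇒m≤ x∈L = let x∈ , 0<x , _ = ∈L⁻ x∈L in m≤ x∈ 0<x

    sums-L≥m+m : ∀ {x} → x ∈ₗ sums L → m + m ≤ x
    sums-L≥m+m x∈ with a , b , a∈ , b∈ , refl ← ∈-sums⁻ {L} x∈ =
      +-mono-≤ (∈L⇒m≤ a∈) (∈L⇒m≤ b∈)

    -- By `∈R⁺` and `∈R⁻` its members are exactly the positive elements of `S` below `c + m`.
    R : List ℕ
    R = L ++ interval c m

    R-unique : Unique R
    R-unique = Unique.++⁺ L-unique (interval-unique c m)
      λ (x∈L , x∈I) → <⇒≱ (proj₂ (proj₂ (∈L⁻ x∈L))) (proj₁ (∈-interval⁻ x∈I))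

    ∈R⁺ : ∀ {x} → Carrier S x → 0 < x → x < c + m → x ∈ₗ R
    ∈R⁺ {x} x∈ 0<x x<c+m with x <? c
    ... | yes x<c = ∈-++⁺ˡ (∈L⁺ x∈ 0<x x<c)
    ... | no  x≮c = ∈-++⁺ʳ L (∈-interval⁺ (≮⇒≥ x≮c) x<c+m)

    ∈R⁻ : ∀ {x} → x ∈ₗ R → Carrier S x × 0 < x × x < c + m
    ∈R⁻ x∈R with ∈-++⁻ L x∈R
    ... | inj₁ x∈L with x∈ , 0<x , x<c ← ∈L⁻ x∈L = x∈ , 0<x , <-≤-trans x<c (m≤m+n c m)
    ... | inj₂ x∈I with c≤x , x<c+m ← ∈-interval⁻ x∈I =
      c≤⇒∈ c≤x , <-≤-trans 0<c c≤x , x<c+m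

    -- An element `x ≥ c + m` splits as `m + (x ∸ m)` with `x ∸ m ≥ c` in `S`, so it is not a
    -- generator.
    gens⊆R : ∀ {x} → x ∈ₗ gens → x ∈ₗ R
    gens⊆R {x} x∈gens = ∈R⁺ (gens⊆S x∈gens) (gens>0 x∈gens) (≰⇒> λ c+m≤x →
      let c≤x∸m : c ≤ x ∸ m
          c≤x∸m = subst (_≤ x ∸ m) (m+n∸n≡m c m) (∸-monoˡ-≤ m c+m≤x)
      in gens∌+ m∈ (c≤⇒∈ c≤x∸m) 0<m (<-≤-trans 0<c c≤x∸m)
           (subst (_∈ₗ gens) (sym (m+[n∸m]≡n (≤-trans (m≤n+m m c) c+m≤x))) x∈gens))

    decomposables : ∃[ D ] R ↭ gens ++ D
    decomposables = Unique-⊆⇒↭ gens-unique gens⊆R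

    module _ {D : List ℕ} (R↭gens++D : R ↭ gens ++ D) where

      private
        d : ℕ
        d = length D

      D-unique : Unique D
      D-unique = Unique-++⁻ʳ gens (Unique-resp-↭ R↭gens++D R-unique)

      D⊆R : ∀ {x} → x ∈ₗ D → x ∈ₗ R
      D⊆R x∈D = ∈-resp-↭ (↭-sym R↭gens++D) (∈-++⁺ʳ gens x∈D)

      -- A non-generator is `y + z` with positive `y`, `z` in `S`. As each is at least `m` and the
      -- sum is below `c + m`, the other is below `c`, so both lie in `L`.
      D⊆sums : ∀ {x} → x ∈ₗ D → x ∈ₗ sums L
      D⊆sums x∈D with x∈ , 0<x , x<c+m ← ∈R⁻ (D⊆R x∈D)
        with y , z , 0<y , 0<z , y∈ , z∈ , refl ← ∉gens⇒+ x∈ 0<x (λ x∈gens →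
          Unique-++⇒disjoint (Unique-resp-↭ R↭gens++D R-unique) x∈gens x∈D)
        = ∈-sums⁺
            (∈L⁺ y∈ 0<y (+-cancelʳ-< m y c (≤-<-trans (+-monoʳ-≤ y (m≤ z∈ 0<z)) x<c+m)))
            (∈L⁺ z∈ 0<z (+-cancelʳ-< m z c (≤-<-trans (+-monoʳ-≤ z (m≤ y∈ 0<y))
              (subst (_< c + m) (+-comm y z) x<c+m))))

      sums⊆D : ∀ {x} → x ∈ₗ sums L → x < c + m → x ∈ₗ D
      sums⊆D x∈sums x<c+m with a , b , a∈L , b∈L , refl ← ∈-sums⁻ {L} x∈sums
        with a∈ , 0<a , _ ← ∈L⁻ a∈L | b∈ , 0<b , _ ← ∈L⁻ b∈L
        with ∈-++⁻ gens (∈-resp-↭ R↭gens++D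
               (∈R⁺ (+-closed a∈ b∈) (<-≤-trans 0<a (m≤m+n a b)) x<c+m))
      ... | inj₁ x∈gens = ⊥-elim (gens∌+ a∈ b∈ 0<a 0<b x∈gens)
      ... | inj₂ x∈D    = x∈D

      -- The upper end is `c + m = 2m + q`. This inclusion yields `d ≤ q`, with slack `j`.
      D⊆interval : ∀ {x} → x ∈ₗ D → x ∈ₗ interval (m + m) q
      D⊆interval {x} x∈D = ∈-interval⁺ (sums-L≥m+m (D⊆sums x∈D))
        (subst (x <_) shuffle (proj₂ (proj₂ (∈R⁻ (D⊆R x∈D)))))
        where
        rearrange : ∀ m q → m + q + m ≡ m + m + q
        rearrange = solve-∀
        shuffle : c + m ≡ m + m + q
        shuffle = trans (cong (_+ m) c≡m+q) (rearrange m q)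

      l+m≡e+d : l + m ≡ e + d
      l+m≡e+d = begin
        l + m                       ≡⟨ cong (l +_) (length-applyUpTo (c +_) m) ⟨
        l + length (interval c m)   ≡⟨ length-++ L ⟨
        length R                    ≡⟨ length[↭++] gens R↭gens++D ⟩
        e + d                       ∎
        where open ≡-Reasoning

      -- Under these conditions `D` is a rearrangement of `sums L`, so `d = t`. This computes `e`
      -- for the explicit semigroups.
      length-gens : Unique (sums L) → (∀ {x} → x ∈ₗ sums L → x < c + m) →
                    e + t ≡ l + m
      length-gens u small = trans (cong (e +_) t≡d) (sym l+m≡e+d)
        where
        t≡d : t ≡ d
        t≡d = ↭-length (Unique-≐⇒↭ D-unique u D⊆sums (λ x∈ → sums⊆D x∈ (small x∈)))

      wilf-cases : e * suc l ≡ c →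
        (l ≡ 0 × c ≡ m) ⊎ (l ≡ 1 × c ≡ 2 * m) ⊎
        (2 ≤ l × c ≡ 2 * m × sums L ↭ interval (m + m) m)
      wilf-cases e*n≡c
        -- `Z` holds the surplus entries of `sums L` over `D`, and `Z′` the members of
        -- `[2m , 2m + q)` outside `D`. Their lengths are `k` and `j`.
        with Z , sums↭ ← Unique-⊆⇒↭ D-unique D⊆sums
        with Z′ , interval↭ ← Unique-⊆⇒↭ D-unique D⊆interval
        = by-length l refl
        where
        i j k : ℕ
        i = m ∸ q
        j = length Z′
        k = length Z

        t≡d+k : t ≡ d + k
        t≡d+k = length[↭++] D sums↭

        q≡d+j : q ≡ d + j
        q≡d+j = trans (sym (length-applyUpTo (m + m +_) q)) (length[↭++] D interval↭)

        m≡d+j+i : m ≡ d + j + i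
        m≡d+j+i = trans (sym (m+[n∸m]≡n q≤m)) (cong (_+ i) q≡d+j)

        2j≡ : 2 * j ≡ 2 * k + suc l * j + l * i
        2j≡ = +-cancelˡ-≡ c _ _ (begin
          c + 2 * j
            ≡⟨ cong (_+ 2 * j) (trans (sym e*n≡c) (*-comm e (suc l))) ⟩
          suc l * e + 2 * j
            ≡⟨ wilf-identity {l} {e} {d} {i} {j} {k} (trans (cong (l +_) (sym m≡d+j+i)) l+m≡e+d)
                 (trans (cong (2 *_) (sym t≡d+k)) (length-sums L)) ⟩
          (d + j + i) + (d + j) + (2 * k + suc l * j + l * i)
            ≡⟨ cong (_+ (2 * k + suc l * j + l * i)) (trans c≡m+q (cong₂ _+_ m≡d+j+i q≡d+j)) ⟨
          c + (2 * k + suc l * j + l * i) ∎)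
          where open ≡-Reasoning

        i≡0⇒m≡q : i ≡ 0 → m ≡ q
        i≡0⇒m≡q i≡0 = ≤-antisym (m∸n≡0⇒m≤n i≡0) q≤m

        c≡2m : i ≡ 0 → c ≡ 2 * m
        c≡2m i≡0 = trans c≡m+q (cong (m +_) (trans (sym (i≡0⇒m≡q i≡0)) (sym (+-identityʳ m))))

        by-length : ∀ l′ → l ≡ l′ →
          (l ≡ 0 × c ≡ m) ⊎ (l ≡ 1 × c ≡ 2 * m) ⊎
          (2 ≤ l × c ≡ 2 * m × sums L ↭ interval (m + m) m)
        -- Without nonzero small elements there are no sums, so `d` and `k` vanish; the equation
        -- becomes `2j = j`, giving `q = d + j = 0`.
        by-length zero l≡0 = inj₁ (l≡0 , trans c≡m+q (trans (cong (m +_) q≡0) (+-identityʳ m)))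
          where
          t≡0 : t ≡ 0
          t≡0 = m+n≡0⇒m≡0 t (trans (length-sums L) (cong (λ z → z * suc z) l≡0))
          k≡0 : k ≡ 0
          k≡0 = m+n≡0⇒n≡0 d (trans (sym t≡d+k) t≡0)
          j≡0 : j ≡ 0
          j≡0 = +-cancelʳ-≡ (1 * j) j 0 (trans 2j≡ (begin
            2 * k + suc l * j + l * i   ≡⟨ cong₂ (λ a b → 2 * a + suc b * j + b * i) k≡0 l≡0 ⟩
            1 * j + 0                   ≡⟨ +-identityʳ (1 * j) ⟩
            1 * j                       ∎))
            where open ≡-Reasoning
          q≡0 : q ≡ 0
          q≡0 = trans q≡d+j (cong₂ _+_ (m+n≡0⇒m≡0 d (trans (sym t≡d+k) t≡0)) j≡0)
        by-length (suc l′) l≡ with wilf-zero {l′} {i} {j} {k}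
          (trans 2j≡ (cong (λ z → 2 * k + suc z * j + z * i) l≡))
        by-length (suc zero) l≡1 | i≡0 , _ , _ = inj₂ (inj₁ (l≡1 , c≡2m i≡0))
        -- Since `k` and `j` vanish, `D` is a rearrangement of both `sums L` and the interval, whose
        -- length `q` equals `m` because `i` vanishes.
        by-length (suc (suc l″)) l≡ | i≡0 , k≡0 , inj₂ j≡0 = inj₂ (inj₂
          ( subst (2 ≤_) (sym l≡) (s≤s (s≤s z≤n))
          , c≡2m i≡0
          , ↭-trans (↭++-empty sums↭ k≡0)
              (↭-sym (subst (λ z → interval (m + m) z ↭ D) (sym (i≡0⇒m≡q i≡0))
                (↭++-empty interval↭ j≡0)))))

-- Multiplicity, conductor and Wilf number

module _ (S : NumericalSemigroup) where

  open NumericalSemigroup S using (_∈?; 0∈; +-closed)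

  private
    m e : ℕ
    m = multiplicity S
    e = embeddingDimension S

  multiplicity∈ : Carrier S m
  multiplicity∈ = proj₁ (proj₁ (proj₂ (leastPositive S)))

  0<multiplicity : 0 < m
  0<multiplicity = proj₂ (proj₁ (proj₂ (leastPositive S)))

  multiplicity≤ : ∀ {x} → Carrier S x → 0 < x → m ≤ x
  multiplicity≤ x∈ 0<x = proj₂ (proj₂ (leastPositive S)) (x∈ , 0<x)

  multiplicity-unique : ∀ {a} → Carrier S a → 0 < a →
                        (∀ {x} → Carrier S x → 0 < x → a ≤ x) → m ≡ a
  multiplicity-unique a∈ 0<a least =
    ≤-antisym (multiplicity≤ a∈ 0<a) (least multiplicity∈ 0<multiplicity)

  module _ (S≢ℕ : Proper S) where

    private
      c : ℕ
      c = conductor S S≢ℕ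

      left : List ℕ
      left = filter _∈? (upTo c)

    frobenius∉ : ¬ Carrier S (frobenius S S≢ℕ)
    frobenius∉ = proj₁ (proj₂ (greatestGap S S≢ℕ))

    conductor≤⇒∈ : ∀ {x} → c ≤ x → Carrier S x
    conductor≤⇒∈ {x} c≤x = decidable-stable (x ∈?) λ x∉ →
      <⇒≱ c≤x (proj₂ (proj₂ (greatestGap S S≢ℕ)) x∉)

    gap<conductor : ∀ {x} → ¬ Carrier S x → x < c
    gap<conductor x∉ = ≰⇒> λ c≤x → x∉ (conductor≤⇒∈ c≤x)

    conductor≤ : ∀ {a} → (∀ {x} → a ≤ x → Carrier S x) → c ≤ a
    conductor≤ above = ≰⇒> λ a≤F → frobenius∉ (above a≤F)

    multiplicity≤conductor : m ≤ c
    multiplicity≤conductor = multiplicity≤ (conductor≤⇒∈ ≤-refl) z<s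

    left-unique : Unique left
    left-unique = Unique.filter⁺ _∈? (Unique.upTo⁺ c)

    left↭ : ∀ {xs} → Unique xs → (∀ {x} → x ∈ₗ xs → Carrier S x × x < c) →
            (∀ {x} → Carrier S x → x < c → x ∈ₗ xs) → left ↭ xs
    left↭ u xs⊆ ⊆xs = Unique-≐⇒↭ u left-unique
      (λ x∈ → ∈-filter⁺ _∈? (∈-upTo⁺ (proj₂ (xs⊆ x∈))) (proj₁ (xs⊆ x∈)))
      (λ x∈ → let p = ∈-filter⁻ _∈? x∈ in ⊆xs (proj₂ p) (∈-upTo⁻ (proj₁ p)))

    -- Splitting off 0 leaves the nonzero small elements, whence `n(S) = l + 1`.
    left↭0∷ : ∃[ L ] left ↭ 0 ∷ L
    left↭0∷ = Unique-⊆⇒↭ {xs = 0 ∷ []} ([] ∷ []) λ { (here refl) → ∈-filter⁺ _∈? (∈-upTo⁺ z<s) 0∈ }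

    wilf≡0⇒ : wilfNumber S S≢ℕ ≡ 0ℤ → e * leftCount S S≢ℕ ≡ c
    wilf≡0⇒ W≡0 = ℤ.+-injective (ℤ.i-j≡0⇒i≡j _ _ W≡0)

    ⇒wilf≡0 : e * leftCount S S≢ℕ ≡ c → wilfNumber S S≢ℕ ≡ 0ℤ
    ⇒wilf≡0 eq = ℤ.i≡j⇒i-j≡0 (cong Data.Integer.+_ eq)

    module _ (c≤2m : c ≤ 2 * m) {L : List ℕ} (left↭0∷L : left ↭ 0 ∷ L) where

      private
        0∷L-unique : Unique (0 ∷ L)
        0∷L-unique = Unique-resp-↭ left↭0∷L left-unique

        n≡1+l : leftCount S S≢ℕ ≡ suc (length L)
        n≡1+l = ↭-length left↭0∷L

      ∈L⁺ : ∀ {x} → Carrier S x → 0 < x → x < c → x ∈ₗ L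
      ∈L⁺ x∈ 0<x x<c with ∈-resp-↭ left↭0∷L (∈-filter⁺ _∈? (∈-upTo⁺ x<c) x∈)
      ... | here refl = ⊥-elim (n≮0 0<x)
      ... | there x∈L = x∈L

      ∈L⁻ : ∀ {x} → x ∈ₗ L → Carrier S x × 0 < x × x < c
      ∈L⁻ x∈L with p ← ∈-filter⁻ _∈? (∈-resp-↭ (↭-sym left↭0∷L) (there x∈L)) =
          proj₂ p
        , n≢0⇒n>0 (λ { refl → Unique-++⇒disjoint {xs = 0 ∷ []} 0∷L-unique (here refl) x∈L })
        , ∈-upTo⁻ (proj₁ p)

      private
        open module Count′ = Count S
          (proj₁ (proj₂ (minimalSystem S))) (proj₂ (proj₂ (minimalSystem S)))
          multiplicity∈ 0<multiplicity multiplicity≤ z<s conductor≤⇒∈ c≤2m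
          (Unique-++⁻ʳ (0 ∷ []) 0∷L-unique) ∈L⁺ ∈L⁻
          using (decomposables)

      embeddingDimension-formula : Unique (sums L) → (∀ {x} → x ∈ₗ sums L → x < c + m) →
                                   e + length (sums L) ≡ length L + m
      embeddingDimension-formula = Count′.length-gens (proj₂ decomposables)

      wilf≡0-cases : wilfNumber S S≢ℕ ≡ 0ℤ →
        (length L ≡ 0 × c ≡ m) ⊎ (length L ≡ 1 × c ≡ 2 * m) ⊎
        (2 ≤ length L × c ≡ 2 * m × sums L ↭ interval (m + m) m)
      wilf≡0-cases W≡0 =
        Count′.wilf-cases (proj₂ decomposables) (subst (λ n → e * n ≡ c) n≡1+l (wilf≡0⇒ W≡0))

    -- Multiplicity 1 would put every number into `S`, the Frobenius number included.
    1<multiplicity : 1 < m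
    1<multiplicity = ≤∧≢⇒< 0<multiplicity λ 1≡m →
      frobenius∉ (all (subst (Carrier S) (sym 1≡m) multiplicity∈) _)
      where
      all : Carrier S 1 → ∀ x → Carrier S x
      all 1∈ zero    = 0∈
      all 1∈ (suc x) = +-closed 1∈ (all 1∈ x)

    <multiplicity⇒0 : ∀ {x} → Carrier S x → x < m → x ≡ 0
    <multiplicity⇒0 {zero}  _  _   = refl
    <multiplicity⇒0 {suc x} x∈ x<m = ⊥-elim (<⇒≱ x<m (multiplicity≤ x∈ z<s))

    -- Recognising the listed semigroups from their small elements

    conductor≡m⇒T1 : c ≡ m → Carrier S ≐ T m 1
    conductor≡m⇒T1 c≡m = to , from
      where
      to : ∀ {x} → Carrier S x → T m 1 x
      to {x} x∈ with x <? m
      ... | yes x<m = inj₁ (0 , z<s , <multiplicity⇒0 x∈ x<m)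
      ... | no  x≮m = inj₂ (subst (_≤ x) (sym (*-identityˡ m)) (≮⇒≥ x≮m))
      from : ∀ {x} → T m 1 x → Carrier S x
      from (inj₁ (zero , _ , refl)) = 0∈
      from (inj₁ (suc i , s≤s () , _))
      from {x} (inj₂ m≤x) =
        conductor≤⇒∈ (subst (_≤ x) (trans (*-identityˡ m) (sym c≡m)) m≤x)

    conductor≡2m⇒multiplicity< : c ≡ 2 * m → m < c
    conductor≡2m⇒multiplicity< c≡2m =
      subst (m <_) (sym c≡2m) (m<m+n m (<-≤-trans 0<multiplicity (m≤m+n m 0)))

    conductor≡2m⇒T2 : c ≡ 2 * m → (∀ {x} → Carrier S x → 0 < x → x < c → x ≡ m) →
                      Carrier S ≐ T m 2
    conductor≡2m⇒T2 c≡2m only-m = to , from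
      where
      to : ∀ {x} → Carrier S x → T m 2 x
      to {zero}  _ = inj₁ (0 , z<s , refl)
      to {suc x} x∈ with suc x <? c
      ... | yes x<c = inj₁ (1 , ≤-refl , trans (only-m x∈ z<s x<c) (sym (*-identityˡ m)))
      ... | no  x≮c = inj₂ (subst (_≤ suc x) c≡2m (≮⇒≥ x≮c))
      from : ∀ {x} → T m 2 x → Carrier S x
      from (inj₁ (zero , _ , refl)) = 0∈
      from (inj₁ (suc zero , _ , refl)) = subst (Carrier S) (sym (*-identityˡ m)) multiplicity∈
      from (inj₁ (suc (suc i) , s≤s (s≤s ()) , _))
      from {x} (inj₂ 2m≤x) = conductor≤⇒∈ (subst (_≤ x) (sym c≡2m) 2m≤x)

    conductor≡6⇒⟨3,4⟩ : c ≡ 6 → left ↭ 0 ∷ 3 ∷ 4 ∷ [] → Carrier S ≐ ⟨3,4⟩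
    conductor≡6⇒⟨3,4⟩ c≡6 left↭034 = to , ⟨3,4⟩⊆S
      where
      034⊆⟨3,4⟩ : ∀ {x} → x ∈ₗ (0 ∷ 3 ∷ 4 ∷ []) → ⟨3,4⟩ x
      034⊆⟨3,4⟩ (here refl) = zero
      034⊆⟨3,4⟩ (there x∈)  = gen x∈
      to : ∀ {x} → Carrier S x → ⟨3,4⟩ x
      to {x} x∈ with x <? c
      ... | yes x<c = 034⊆⟨3,4⟩ (∈-resp-↭ left↭034 (∈-filter⁺ _∈? (∈-upTo⁺ x<c) x∈))
      ... | no  x≮c = 6≤⇒∈⟨3,4⟩ (subst (_≤ x) c≡6 (≮⇒≥ x≮c))
      ⟨3,4⟩⊆S : ∀ {x} → ⟨3,4⟩ x → Carrier S x
      ⟨3,4⟩⊆S (gen x∈)  = proj₂ (∈-filter⁻ _∈? (∈-resp-↭ (↭-sym left↭034) (there x∈)))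
      ⟨3,4⟩⊆S zero      = 0∈
      ⟨3,4⟩⊆S (add p q) = +-closed (⟨3,4⟩⊆S p) (⟨3,4⟩⊆S q)

    -- Multiplicity and conductor of the listed semigroups

    T⇒multiplicity : ∀ {a k} → 0 < a → 0 < k → Carrier S ≐ T a k → m ≡ a
    T⇒multiplicity 0<a 0<k (S⊆T , T⊆S) =
      multiplicity-unique (T⊆S (∈T 0<k)) 0<a (λ x∈ → ∈T⇒≤ 0<k (S⊆T x∈))

    T1⇒conductor : Carrier S ≐ T m 1 → c ≡ m
    T1⇒conductor (_ , T⊆S) = ≤-antisym
      (conductor≤ λ {x} m≤x → T⊆S (inj₂ (subst (_≤ x) (sym (*-identityˡ m)) m≤x)))
      multiplicity≤conductor

    T2⇒conductor : ∀ {a} → 1 < a → Carrier S ≐ T a 2 → c ≡ 2 * a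
    T2⇒conductor {suc (suc b)} (s≤s (s≤s z≤n)) (S⊆T , T⊆S) = ≤-antisym
      (conductor≤ λ 2a≤x → T⊆S (inj₂ 2a≤x))
      (subst (_≤ c) (cong (a +_) (sym (+-identityʳ a))) (gap<conductor (2a-1∉T ∘ S⊆T)))
      where
      a : ℕ
      a = suc (suc b)
      -- With `a = b + 2` this number is `2a - 1`. It lies strictly between `a` and `2a` because
      -- `a > 1`, so it is a gap and `c` is at least `2a`.
      2a-1∉T : ¬ T a 2 (suc b + a)
      2a-1∉T (inj₁ (suc zero , _ , eq)) = m≢1+n+m a (sym (trans eq (+-identityʳ a)))
      2a-1∉T (inj₁ (suc (suc i) , s≤s (s≤s ()) , _))
      2a-1∉T (inj₂ 2a≤) = 1+n≰n (subst (_≤ suc b + a) (cong (a +_) (+-identityʳ a)) 2a≤)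

    ⟨3,4⟩⇒multiplicity : Carrier S ≐ ⟨3,4⟩ → m ≡ 3
    ⟨3,4⟩⇒multiplicity (S⊆ , ⊆S) =
      multiplicity-unique (⊆S 3∈⟨3,4⟩) z<s (λ x∈ → ∈⟨3,4⟩⇒3≤ (S⊆ x∈))

    ⟨3,4⟩⇒conductor : Carrier S ≐ ⟨3,4⟩ → c ≡ 6
    ⟨3,4⟩⇒conductor (S⊆ , ⊆S) =
      ≤-antisym (conductor≤ (⊆S ∘ 6≤⇒∈⟨3,4⟩)) (gap<conductor (5∉ ∘ ∈⟨3,4⟩-cases ∘ S⊆))
      where
      5∉ : ¬ (5 ∈ₗ (0 ∷ 3 ∷ 4 ∷ []) ⊎ 6 ≤ 5)
      5∉ (inj₁ (here ()))
      5∉ (inj₁ (there (here ())))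
      5∉ (inj₁ (there (there (here ()))))
      5∉ (inj₁ (there (there (there ()))))
      5∉ (inj₂ 6≤5) = 1+n≰n 6≤5

    -- The two implications

    module _ (c≤2m : c ≤ 2 * m) where

      -- The parameter `a` is the expected embedding dimension: distinct sums below `c + m` give
      -- `e + t = l + m`, and `a` solves the same equation.
      embeddingDimension⇒wilf≡0 : ∀ {L a} → left ↭ 0 ∷ L → Unique (sums L) →
        (∀ {x} → x ∈ₗ sums L → x < c + m) → a + length (sums L) ≡ length L + m →
        a * suc (length L) ≡ c → wilfNumber S S≢ℕ ≡ 0ℤ
      embeddingDimension⇒wilf≡0 {L} {a} p u small a≡ an≡c =
        ⇒wilf≡0 (trans (cong₂ _*_ e≡a (↭-length p)) an≡c)
        where
        e≡a : e ≡ a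
        e≡a = +-cancelʳ-≡ (length (sums L)) e a
          (trans (embeddingDimension-formula c≤2m p u small) (sym a≡))

      T1⇒wilf≡0 : Carrier S ≐ T m 1 → wilfNumber S S≢ℕ ≡ 0ℤ
      -- No nonzero small elements: `e = m`, `n = 1` and `c = m`.
      T1⇒wilf≡0 S≐T = embeddingDimension⇒wilf≡0 {[]} {m}
        (left↭ ([] ∷ [])
          (λ { (here refl) → 0∈ , z<s })
          (λ x∈ x<c → here (<multiplicity⇒0 x∈ (subst (_ <_) c≡m x<c))))
        [] (λ ()) (+-identityʳ m) (trans (*-identityʳ m) (sym c≡m))
        where
        c≡m : c ≡ m
        c≡m = T1⇒conductor S≐T

      T2⇒wilf≡0 : Carrier S ≐ T m 2 → wilfNumber S S≢ℕ ≡ 0ℤ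
      -- The only sum is `2m`, below `c + m = 3m`: `e = m`, `n = 2` and `c = 2m`.
      T2⇒wilf≡0 S≐T@(S⊆T , _) = embeddingDimension⇒wilf≡0 {m ∷ []} {m}
        (left↭ ((<⇒≢ 0<multiplicity ∷ []) ∷ [] ∷ [])
          (λ { (here refl) → 0∈ , z<s ; (there (here refl)) → multiplicity∈ , m<c })
          (λ x∈ x<c → below (S⊆T x∈) x<c))
        ([] ∷ []) (λ { (here refl) → +-monoˡ-< m m<c })
        (+-comm m 1) (trans (*-comm m 2) (sym c≡2m))
        where
        c≡2m : c ≡ 2 * m
        c≡2m = T2⇒conductor 1<multiplicity S≐T
        m<c : m < c
        m<c = conductor≡2m⇒multiplicity< c≡2m
        below : ∀ {x} → T m 2 x → x < c → x ∈ₗ (0 ∷ m ∷ [])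
        below (inj₁ (zero , _ , refl)) _ = here refl
        below (inj₁ (suc zero , _ , refl)) _ = there (here (*-identityˡ m))
        below (inj₁ (suc (suc i) , s≤s (s≤s ()) , _)) _
        below {x} (inj₂ 2m≤x) x<c = ⊥-elim (<⇒≱ x<c (subst (_≤ x) (sym c≡2m) 2m≤x))

      ⟨3,4⟩⇒wilf≡0 : Carrier S ≐ ⟨3,4⟩ → wilfNumber S S≢ℕ ≡ 0ℤ
      -- The sums 6, 7, 8 are distinct and below `c + m = 9`: `e = 2`, `n = 3` and `c = 6`.
      ⟨3,4⟩⇒wilf≡0 S≐@(S⊆ , ⊆S) = embeddingDimension⇒wilf≡0 {3 ∷ 4 ∷ []} {2}
        (left↭ (((λ ()) ∷ (λ ()) ∷ []) ∷ ((λ ()) ∷ []) ∷ [] ∷ [])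
          (λ { (here refl) → 0∈ , z<s
             ; (there (here refl)) → ⊆S 3∈⟨3,4⟩ , <c (m≤m+n 4 2)
             ; (there (there (here refl))) → ⊆S 4∈⟨3,4⟩ , <c (m≤m+n 5 1) })
          (λ {x} x∈ x<c → [ (λ z → z) , (λ 6≤x → ⊥-elim (<⇒≱ x<c (subst (_≤ x) (sym c≡6) 6≤x))) ]′
            (∈⟨3,4⟩-cases (S⊆ x∈))))
        (((λ ()) ∷ (λ ()) ∷ []) ∷ ((λ ()) ∷ []) ∷ [] ∷ [])
        (λ {x} x∈ → subst (x <_) (sym (cong₂ _+_ c≡6 m≡3)) (<9 x∈))
        (cong (2 +_) (sym m≡3)) (sym c≡6)
        where
        m≡3 : m ≡ 3
        m≡3 = ⟨3,4⟩⇒multiplicity S≐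
        c≡6 : c ≡ 6
        c≡6 = ⟨3,4⟩⇒conductor S≐
        <c : ∀ {x} → x < 6 → x < c
        <c {x} = subst (x <_) (sym c≡6)
        <9 : ∀ {x} → x ∈ₗ (6 ∷ 7 ∷ 8 ∷ []) → x < 9
        <9 (here refl) = m≤m+n 7 2
        <9 (there (here refl)) = m≤m+n 8 1
        <9 (there (there (here refl))) = ≤-refl

      wilf≡0⇒classification : wilfNumber S S≢ℕ ≡ 0ℤ →
        (Carrier S ≐ T m 1 ⊎ Carrier S ≐ T m 2) ⊎ Carrier S ≐ ⟨3,4⟩
      wilf≡0⇒classification W≡0 = by-cases (wilf≡0-cases c≤2m left↭0∷L W≡0)
        where
        L : List ℕ
        L = proj₁ left↭0∷

        left↭0∷L : left ↭ 0 ∷ L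
        left↭0∷L = proj₂ left↭0∷

        length1 : ∀ {xs : List ℕ} {x y} → length xs ≡ 1 → x ∈ₗ xs → y ∈ₗ xs → x ≡ y
        length1 {_ ∷ []} _ (here refl) (here refl) = refl

        m∈L : c ≡ 2 * m → m ∈ₗ L
        m∈L c≡2m = ∈L⁺ c≤2m left↭0∷L multiplicity∈ 0<multiplicity (conductor≡2m⇒multiplicity< c≡2m)

        m≤L : ∀ {x} → x ∈ₗ L → m ≤ x
        m≤L x∈ = let x∈S , 0<x , _ = ∈L⁻ c≤2m left↭0∷L x∈ in multiplicity≤ x∈S 0<x

        m,1+m⊆L : m ∈ₗ L → suc m ∈ₗ L → ∀ {x} → x ∈ₗ (m ∷ suc m ∷ []) → x ∈ₗ L
        m,1+m⊆L m∈ 1+m∈ (here refl)         = m∈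
        m,1+m⊆L m∈ 1+m∈ (there (here refl)) = 1+m∈

        initial : c ≡ 2 * m → ∀ {K} → left ↭ 0 ∷ m ∷ suc m ∷ K → m ≡ 3 × K ≡ [] →
                  Carrier S ≐ ⟨3,4⟩
        initial c≡2m p (m≡3 , K≡[]) = conductor≡6⇒⟨3,4⟩ (trans c≡2m (cong (2 *_) m≡3))
          (subst₂ (λ a xs → left ↭ 0 ∷ a ∷ suc a ∷ xs) m≡3 K≡[] p)

        -- The list `sums L` depends on the order of `L`. The case analysis is therefore repeated
        -- for the arrangement starting with `m` and `m + 1`; its length is at least 2, so only the
        -- third case remains.
        reorder : c ≡ 2 * m → ∃[ K ] L ↭ m ∷ suc m ∷ K → Carrier S ≐ ⟨3,4⟩
        reorder c≡2m (K , L↭) = initial c≡2m p (third (wilf≡0-cases c≤2m p W≡0))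
          where
          p : left ↭ 0 ∷ m ∷ suc m ∷ K
          p = ↭-trans left↭0∷L (prep 0 L↭)
          third : (suc (suc (length K)) ≡ 0 × c ≡ m) ⊎ (suc (suc (length K)) ≡ 1 × c ≡ 2 * m) ⊎
            (2 ≤ suc (suc (length K)) × c ≡ 2 * m × sums (m ∷ suc m ∷ K) ↭ interval (m + m) m) →
            m ≡ 3 × K ≡ []
          third (inj₂ (inj₂ (_ , _ , sums↭))) = sums-interval⇒3,4 {m} {K} sums↭

        by-cases : (length L ≡ 0 × c ≡ m) ⊎ (length L ≡ 1 × c ≡ 2 * m) ⊎
          (2 ≤ length L × c ≡ 2 * m × sums L ↭ interval (m + m) m) →
          (Carrier S ≐ T m 1 ⊎ Carrier S ≐ T m 2) ⊎ Carrier S ≐ ⟨3,4⟩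
        by-cases (inj₁ (_ , c≡m)) = inj₁ (inj₁ (conductor≡m⇒T1 c≡m))
        by-cases (inj₂ (inj₁ (l≡1 , c≡2m))) = inj₁ (inj₂ (conductor≡2m⇒T2 c≡2m λ x∈ 0<x x<c →
          length1 l≡1 (∈L⁺ c≤2m left↭0∷L x∈ 0<x x<c) (m∈L c≡2m)))
        by-cases (inj₂ (inj₂ (2≤l , c≡2m , sums↭))) = inj₂ (reorder c≡2m
          (Unique-⊆⇒↭ ((<⇒≢ (n<1+n m) ∷ []) ∷ [] ∷ [])
            (m,1+m⊆L (m∈L c≡2m) (sums-interval⇒1+m∈ L sums↭ 2≤l m≤L))))

theorem1p4 : (S : NumericalSemigroup) (S≢ℕ : Proper S) →
    conductor S S≢ℕ ≤ 2 * multiplicity S →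
    (wilfNumber S S≢ℕ ≡ 0ℤ) ⇔
    ((∃[ m ] (2 ≤ m × ((Carrier S ≐ T m 1) ⊎ (Carrier S ≐ T m 2))))
    ⊎ (Carrier S ≐ ⟨ (λ x → x ∈ₗ (3 ∷ 4 ∷ [])) ⟩))
theorem1p4 S S≢ℕ c≤2m = mk⇔ (to ∘ wilf≡0⇒classification S S≢ℕ c≤2m) from
  where
  to : (Carrier S ≐ T (multiplicity S) 1 ⊎ Carrier S ≐ T (multiplicity S) 2) ⊎ Carrier S ≐ ⟨3,4⟩ →
       (∃[ m ] (2 ≤ m × ((Carrier S ≐ T m 1) ⊎ (Carrier S ≐ T m 2)))) ⊎ (Carrier S ≐ ⟨3,4⟩)
  to (inj₁ S≐T)   = inj₁ (multiplicity S , 1<multiplicity S S≢ℕ , S≐T)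
  to (inj₂ S≐3,4) = inj₂ S≐3,4
  from : (∃[ m ] (2 ≤ m × ((Carrier S ≐ T m 1) ⊎ (Carrier S ≐ T m 2)))) ⊎ (Carrier S ≐ ⟨3,4⟩) →
         wilfNumber S S≢ℕ ≡ 0ℤ
  -- The given parameter `a` is first identified with the multiplicity of `S`.
  from (inj₁ (a , 1<a , inj₁ S≐T)) = T1⇒wilf≡0 S S≢ℕ c≤2m
    (subst (λ a → Carrier S ≐ T a 1) (sym (T⇒multiplicity S S≢ℕ (<-trans z<s 1<a) z<s S≐T)) S≐T)
  from (inj₁ (a , 1<a , inj₂ S≐T)) = T2⇒wilf≡0 S S≢ℕ c≤2m
    (subst (λ a → Carrier S ≐ T a 2) (sym (T⇒multiplicity S S≢ℕ (<-trans z<s 1<a) z<s S≐T)) S≐T)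
  from (inj₂ S≐3,4) = ⟨3,4⟩⇒wilf≡0 S S≢ℕ c≤2m S≐3,4
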